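{- (1) For every test $t$, the map $\rho\mapsto\llbracket t\rrbracket_r(\rho)$ is a measurable function from $\Sigma_r$ to $\mathbb{P}^*\{0,1\}$. (2) If $\mathcal{V}$ is finite or $\mathbf{proj}:\mathbb{R}_e\to\mathbb{F}_e$ is measurable, then for every test $t$, the map $\rho\mapsto\llbracket t\rrbracket_f(\rho)$ is a measurable function from $\Sigma_f$ to $\mathbb{P}^*\{0,1\}$.
   Context: $\mathcal{V}$ is a countable set of variables. Expressions: $e ::= a \mid x \mid \dot{ - }e \mid e\,\dot{+}\,e \mid e\,\dot{ - }\,e\mid e\,\dot{\times}\, e\mid e\,\dot{/}\,e$ with $a\in\mathbb{Q}$, $x\in\mathcal{V}$. Tests: $t::= e\,\dot{<=}\,e\mid e\,\dot{<}\,e\mid e\,\dot{==}\,e\mid e\,\dot{!=}\,e\mid\, !t$. Values. $\mathbb{F}\subset\mathbb{R}$ is the finite set of (finite) floating-point numbers, with smallest element $F_{\min}$ and largest element $F_{\max}$. Let $\mathbb{R}_e=\mathbb{R}\cup\{\mathbf{err}\}$, $\mathbb{F}_e=\mathbb{F}\cup\{\mathbf{err}\}$, where $\mathbf{err}$ is an extra symbol. Arithmetic is extended to $\mathbb{R}_e$ by: for $r\in\mathbb{R}_e$ and $\diamond\in\{+,-,\times,/\}$, $\mathbf{err}\diamond r=r\diamond\mathbf{err}=r/0=-\mathbf{err}=\mathbf{err}$. $\mathbf{inj}:\mathbb{F}_e\to\mathbb{R}_e$ is the canonical inclusion. $\mathbf{proj}:\mathbb{R}_e\to\mathbb{F}_e$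 is a fixed map with $\mathbf{proj}(r)=\mathbf{err}$ if $r\notin[F_{\min},F_{\max}]$ (in particular if $r=\mathbf{err}$), and $\mathbf{proj}(\mathbf{inj}(f))=f$ for all $f\in\mathbb{F}_e$. Environments. $\Sigma_r$ is the set of maps $\mathcal{V}\to\mathbb{R}_e$, $\Sigma_f$ the set of maps $\mathcal{V}\to\mathbb{F}_e$. Expression semantics. Real: $\llbracket a\rrbracket_r(\rho)=a$, $\llbracket x\rrbracket_r(\rho)=\rho(x)$, $\llbracket \dot{ - }e\rrbracket_r(\rho)=-\llbracket e\rrbracket_r(\rho)$, $\llbracket e_1\dot{\diamond}e_2\rrbracket_r(\rho)=\llbracket e_1\rrbracket_r(\rho)\diamond\llbracket e_2\rrbracket_r(\rho)$. Floating-point: $\llbracket a\rrbracket_f(\rho)=\mathbf{proj}(a)$, $\llbracket x\rrbracket_f(\rho)=\rho(x)$, $\llbracket \dot{ - }e\rrbracket_f(\rho)=\mathbf{proj}(-\mathbf{inj}(\llbracket e\rrbracket_f(\rho)))$, $\llbracket e_1\dot{\diamond}e_2\rrbracket_f(\rho)=\mathbf{proj}(\mathbf{inj}(\llbracket e_1\rrbracket_f(\rho))\diamond\mathbf{inj}(\llbracket e_2\rrbracket_f(\rho)))$, for $\diamond\in\{+,-,\times,/\}$. Test semantics, for $\star\in\{r,f\}$ and $\rho\in\Sigma_\star$: for a comparison $e_1\,\dot{R}\,e_2$ with $R$ one of $\le,<,=,\ne$ (corresponding to $\dot{<=},\dot{<},\dot{==},\dot{!=}$), $\llbracket e_1\dot{R}e_2\rrbracket_\star(\rho)$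 is $\{0,1\}$ if $\llbracket e_1\rrbracket_\star(\rho)=\mathbf{err}$ or $\llbracket e_2\rrbracket_\star(\rho)=\mathbf{err}$; otherwise it is $\{1\}$ if $\llbracket e_1\rrbracket_\star(\rho)\,R\,\llbracket e_2\rrbracket_\star(\rho)$ holds in $\mathbb{R}$ and $\{0\}$ if not. Moreover $\llbracket !t\rrbracket_\star(\rho)=\{1-v\mid v\in\llbracket t\rrbracket_\star(\rho)\}$. Topology and measurability. $\mathbb{R}_e$ has the topology whose opens are the open subsets of $\mathbb{R}$, the singleton $\{\mathbf{err}\}$, and their unions. $\mathbb{F}_e$ has the discrete topology. $\Sigma_r\cong\mathbb{R}_e^{\mathcal{V}}$ and $\Sigma_f\cong\mathbb{F}_e^{\mathcal{V}}$ have the product topology. All spaces carry their Borel $\sigma$-algebras. $\mathbb{P}^*(Y)$ denotes the set of non-empty subsets of $Y$. For topological spaces $X,Y$, a map $f:X\to\mathbb{P}^*(Y)$ is measurable iff $f^{ -1}(\Diamond U)$ is Borel for every open $U\subseteq Y$, where $\Diamond U$ is the set of subsets of $Y$ that intersect $U$. Here $\{0,1\}$ is discrete. -}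

module Defs where

open import Algebra.Bundles using (CommutativeRing)
open import Data.Fin.Base using (Fin; opposite)
open import Data.Fin.Patterns using (0F; 1F)
import Data.Integer.Base as ℤ
open import Data.List.Base using (List; []; _∷_; _++_)
open import Data.List.Relation.Unary.All as All using (All; []; _∷_)
import Data.List.Relation.Unary.All.Properties as All
open import Data.Maybe.Base as Maybe using (Maybe; just; nothing)
import Data.Maybe.Relation.Binary.Pointwise as Pointwise
open import Data.Nat.Base using (ℕ)
open import Data.Product.Base using (Σ-syntax; ∃; ∃-syntax; _×_; _,_; proj₁; proj₂)
import Data.Rational.Base as ℚ
open import Data.Sum.Base using (_⊎_; inj₁; inj₂)
open import Data.Unit.Polymorphic.Base using (⊤; tt)
open import Function.Base using (_∘_)
open import Function.Bundles using (_⤖_; _↣_)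
open import Function.Definitions using (Injective)
open import Level using (0ℓ; Lift; lift; lower) renaming (suc to lsuc)
open import Relation.Binary.Bundles using (Setoid)
open import Relation.Binary.Core using (Rel)
open import Relation.Binary.Definitions using (_Respects_; tri<; tri≈; tri>)
open import Relation.Binary.Structures using (IsStrictTotalOrder)
import Relation.Binary.Construct.StrictToNonStrict as ToNonStrict
open import Relation.Binary.PropositionalEquality as ≡ using (_≡_)
open import Relation.Nullary.Decidable.Core using (Dec; yes; no; ¬?)
open import Relation.Nullary.Negation.Core using (¬_)
open import Relation.Unary using (Pred; _∈_; _∉_; _≐_; _∩_; _⊢_; _≬_; ∁; ⋃; ｛_｝; Satisfiable)
import Relation.Unary as Unary

Countable : Set → Set
Countable A = A ↣ ℕ

Finite : Set → Set
Finite A = ∃[ n ] (A ⤖ Fin n)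

------------------------------------------------------------------------
-- Topological spaces and measurability

-- The points form a setoid because the real numbers below do.
record Space : Set₂ where
  field
    points : Setoid 0ℓ 0ℓ

  open Setoid points public using (Carrier; _≈_)

  field
    Open      : Pred Carrier 0ℓ → Set₁
    open-resp : ∀ {U} → Open U → U Respects _≈_
    open-≐    : ∀ {U V} → U ≐ V → Open U → Open V
    open-U    : Open Unary.U
    open-∩    : ∀ {U V} → Open U → Open V → Open (U ∩ V)
    open-⋃    : ∀ {I : Set} {U : I → Pred Carrier 0ℓ} →
                (∀ i → Open (U i)) → Open (⋃ I U)

∣_∣ : Space → Set
∣ X ∣ = Space.Carrier X

discrete : Set → Space
discrete A = record
  { points    = ≡.setoid A
  ; Open      = λ _ → ⊤
  ; open-resp = λ {U} _ x≡y → ≡.subst U x≡y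
  ; open-≐    = λ _ _ → tt
  ; open-U    = tt
  ; open-∩    = λ _ _ → tt
  ; open-⋃    = λ _ → tt
  }

-- The power X ^ I with the product topology: a set is open when each of its
-- points has a neighbourhood inside it that constrains finitely many
-- coordinates, each to an open set.
module Power (X : Space) (I : Set) where
  private module X = Space X

  Constraint : Set₁
  Constraint = I × ∃ X.Open

  Satisfies : (I → ∣ X ∣) → Pred Constraint 0ℓ
  Satisfies ρ (i , U , _) = ρ i ∈ U

  Cylinder : List Constraint → Pred (I → ∣ X ∣) (lsuc 0ℓ)
  Cylinder cs ρ = All (Satisfies ρ) cs

  IsOpen : Pred (I → ∣ X ∣) 0ℓ → Set₁
  IsOpen W = ∀ {ρ} → ρ ∈ W →
    Σ[ cs ∈ List Constraint ] ρ ∈ Cylinder cs × (∀ {σ} → σ ∈ Cylinder cs → σ ∈ W)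

_^_ : Space → Set → Space
X ^ I = record
  { points = record
    { Carrier       = I → X.Carrier
    ; _≈_           = λ ρ σ → ∀ i → ρ i X.≈ σ i
    ; isEquivalence = record
      { refl  = λ i → S.refl
      ; sym   = λ p i → S.sym (p i)
      ; trans = λ p q i → S.trans (p i) (q i)
      }
    }
  ; Open      = IsOpen
  ; open-resp = λ oW ρ≈σ ρ∈W → let _ , ρ∈C , C⊆W = oW ρ∈W in
      C⊆W (All.map (λ { {i , _ , oU} → X.open-resp oU (ρ≈σ i) }) ρ∈C)
  ; open-≐    = λ { (W⊆W′ , W′⊆W) oW ρ∈W′ →
      let cs , ρ∈C , C⊆W = oW (W′⊆W ρ∈W′) in cs , ρ∈C , λ σ∈C → W⊆W′ (C⊆W σ∈C) }
  ; open-U    = λ _ → [] , [] , _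
  ; open-∩    = λ { oW oW′ (ρ∈W , ρ∈W′) →
      let cs , ρ∈C , C⊆W = oW ρ∈W ; ds , ρ∈D , D⊆W′ = oW′ ρ∈W′ in
      cs ++ ds , All.++⁺ ρ∈C ρ∈D ,
      λ σ∈ → C⊆W (All.++⁻ˡ cs σ∈) , D⊆W′ (All.++⁻ʳ cs σ∈) }
  ; open-⋃    = λ { oW (i , ρ∈Wi) →
      let cs , ρ∈C , C⊆W = oW i ρ∈Wi in cs , ρ∈C , λ σ∈C → i , C⊆W σ∈C }
  }
  where
  module X = Space X
  module S = Setoid X.points
  open Power X I

-- The Borel σ-algebra, generated by the open sets.
data Borel (X : Space) : Pred ∣ X ∣ 0ℓ → Set₁ where
  open⁺ : ∀ {U} → Space.Open X U → Borel X U
  ∁⁺    : ∀ {A} → Borel X A → Borel X (∁ A)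
  ⋃⁺    : ∀ {A : ℕ → Pred ∣ X ∣ 0ℓ} → (∀ n → Borel X (A n)) → Borel X (⋃ ℕ A)
  resp≐ : ∀ {A B} → A ≐ B → Borel X A → Borel X B

Measurable : (X Y : Space) → (∣ X ∣ → ∣ Y ∣) → Set₁
Measurable X Y f = ∀ {B} → Borel Y B → Borel X (f ⊢ B)

record ℙ* (Y : Space) : Set₁ where
  field
    set       : Pred ∣ Y ∣ 0ℓ
    respects  : set Respects Space._≈_ Y
    non-empty : Satisfiable set

◇ : (Y : Space) → Pred ∣ Y ∣ 0ℓ → Pred (ℙ* Y) 0ℓ
◇ Y U S = ℙ*.set S ≬ U

Measurable* : (X Y : Space) → (∣ X ∣ → ℙ* Y) → Set₁
Measurable* X Y f = ∀ {U} → Space.Open Y U → Borel X (f ⊢ ◇ Y U)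

------------------------------------------------------------------------
-- The real numbers: a Dedekind-complete ordered field, which is classically
-- unique up to unique isomorphism.  Equality is a setoid equality, since
-- standard constructions of the reals need quotients.

record CompleteOrderedField : Set₁ where
  field
    commutativeRing : CommutativeRing 0ℓ 0ℓ

  open CommutativeRing commutativeRing public

  infix  4 _<_ _≤_
  infix  8 _⁻¹

  field
    _<_                : Rel Carrier 0ℓ
    isStrictTotalOrder : IsStrictTotalOrder _≈_ _<_
    0<1                : 0# < 1#
    +-monoˡ-<          : ∀ z {x y} → x < y → x + z < y + z
    *-pos              : ∀ {x y} → 0# < x → 0# < y → 0# < x * y

    -- total, but with an unspecified value at 0#, where it is never used below
    _⁻¹                : Carrier → Carrier
    ⁻¹-inverseʳ        : ∀ {x} → ¬ x ≈ 0# → x * x ⁻¹ ≈ 1#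

  module < = IsStrictTotalOrder isStrictTotalOrder
  open < public using (compare; _≟_; _<?_)

  _≤_ : Rel Carrier 0ℓ
  _≤_ = ToNonStrict._≤_ _≈_ _<_

  _≤?_ : ∀ x y → Dec (x ≤ y)
  _≤?_ = ToNonStrict.decidable′ _≈_ _<_ compare

  UpperBound : Pred Carrier 0ℓ → Pred Carrier 0ℓ
  UpperBound P b = ∀ {x} → x ∈ P → x ≤ b

  field
    supremum : ∀ (P : Pred Carrier 0ℓ) → Satisfiable P → Satisfiable (UpperBound P) →
               ∃[ s ] s ∈ UpperBound P × (∀ {b} → b ∈ UpperBound P → s ≤ b)

module Reals (𝓡 : CompleteOrderedField) where
  open CompleteOrderedField 𝓡 public
  open import Algebra.Definitions.RawMonoid +-rawMonoid public
    using () renaming (_×_ to _·_)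

  ℝ : Set
  ℝ = Carrier

  fromℤ : ℤ.ℤ → ℝ
  fromℤ (ℤ.+ n)      = n · 1#
  fromℤ (ℤ.-[1+ n ]) = - (ℕ.suc n · 1#)

  fromℚ : ℚ.ℚ → ℝ
  fromℚ q = fromℤ (ℚ.↥ q) * fromℤ (ℚ.↧ q) ⁻¹

  IsOpenℝ : Pred ℝ 0ℓ → Set
  IsOpenℝ U = ∀ {x} → x ∈ U →
    ∃[ a ] ∃[ b ] (a < x × x < b) × (∀ {y} → a < y → y < b → y ∈ U)

  private
    resp : ∀ {U} → IsOpenℝ U → U Respects _≈_
    resp oU x≈y x∈U = let _ , _ , (a<x , x<b) , ⊆U = oU x∈U in
      ⊆U (<.<-respʳ-≈ x≈y a<x) (<.<-respˡ-≈ x≈y x<b)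

    whole : IsOpenℝ Unary.U
    whole {x} _ = - 1# + x , 1# + x ,
      ( <.<-respʳ-≈ (trans (sym (+-assoc 1# (- 1#) x))
                      (trans (+-congʳ (-‿inverseʳ 1#)) (+-identityˡ x)))
          (<.<-respˡ-≈ (+-identityˡ _) (+-monoˡ-< (- 1# + x) 0<1))
      , <.<-respˡ-≈ (+-identityˡ x) (+-monoˡ-< x 0<1) ) , _

    meet-above : ∀ {a a′ x} → a < x → a′ < x →
                 ∃[ c ] c < x × (∀ {y} → c < y → a < y × a′ < y)
    meet-above {a} {a′} a<x a′<x with compare a a′
    ... | tri< a<a′ _ _ = a′ , a′<x , λ p → <.trans a<a′ p , p
    ... | tri≈ _ a≈a′ _ = a′ , a′<x , λ p → <.<-respˡ-≈ (sym a≈a′) p , p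
    ... | tri> _ _ a′<a = a , a<x , λ p → p , <.trans a′<a p

    meet-below : ∀ {b b′ x} → x < b → x < b′ →
                 ∃[ c ] x < c × (∀ {y} → y < c → y < b × y < b′)
    meet-below {b} {b′} x<b x<b′ with compare b b′
    ... | tri< b<b′ _ _ = b , x<b , λ p → p , <.trans p b<b′
    ... | tri≈ _ b≈b′ _ = b , x<b , λ p → p , <.<-respʳ-≈ b≈b′ p
    ... | tri> _ _ b′<b = b′ , x<b′ , λ p → <.trans p b′<b , p

    meet : ∀ {U V} → IsOpenℝ U → IsOpenℝ V → IsOpenℝ (U ∩ V)
    meet oU oV (x∈U , x∈V) =
      let _ , _ , (a<x , x<b) , ⊆U   = oU x∈U
          _ , _ , (a′<x , x<b′) , ⊆V = oV x∈V
          c , c<x , above = meet-above a<x a′<x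
          d , x<d , below = meet-below x<b x<b′
      in c , d , (c<x , x<d) , λ c<y y<d →
           ⊆U (proj₁ (above c<y)) (proj₁ (below y<d)) ,
           ⊆V (proj₂ (above c<y)) (proj₂ (below y<d))

  -- Adjoining err

  pattern err = nothing

  -- The coproduct topology on ℝ ⊎ {err}: U ⊆ ℝₑ is an open subset of ℝ,
  -- possibly together with err, precisely when U ∩ ℝ is open.
  ℝₑ-space : Space
  ℝₑ-space = record
    { points    = Pointwise.setoid setoid
    ; Open      = λ U → Lift _ (IsOpenℝ (just ⊢ U))
    ; open-resp = λ { (lift oU) (Pointwise.just x≈y) → resp oU x≈y
                    ; _         Pointwise.nothing    → λ p → p }
    ; open-≐    = λ { (U⊆V , V⊆U) (lift oU) → lift λ x∈V →
        let a , b , axb , ⊆U = oU (V⊆U x∈V) in a , b , axb , λ p q → U⊆V (⊆U p q) }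
    ; open-U    = lift whole
    ; open-∩    = λ { (lift oU) (lift oV) → lift (meet oU oV) }
    ; open-⋃    = λ oU → lift λ { (i , x∈Ui) →
        let a , b , axb , ⊆U = lower (oU i) x∈Ui in a , b , axb , λ p q → i , ⊆U p q }
    }

  ℝₑ : Set
  ℝₑ = Maybe ℝ

  infix 4 _≈ₑ_
  _≈ₑ_ : Rel ℝₑ 0ℓ
  _≈ₑ_ = Space._≈_ ℝₑ-space

  -ₑ_ : ℝₑ → ℝₑ
  -ₑ_ = Maybe.map (λ x → - x)

  _+ₑ_ _-ₑ_ _×ₑ_ _/ₑ_ : ℝₑ → ℝₑ → ℝₑ
  _+ₑ_ = Maybe.zipWith _+_
  _-ₑ_ = Maybe.zipWith _-_
  _×ₑ_ = Maybe.zipWith _*_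
  just x /ₑ just y with y ≟ 0#
  ... | yes _ = err
  ... | no  _ = just (x * y ⁻¹)
  just _ /ₑ err = err
  err    /ₑ _   = err

  _∈ₑ[_,_] : ℝₑ → ℝ → ℝ → Set
  r ∈ₑ[ a , b ] = ∃[ x ] r ≡ just x × a ≤ x × x ≤ b

record FloatingPoint (𝓡 : CompleteOrderedField) : Set₁ where
  open Reals 𝓡
  field
    𝔽               : Set
    𝔽-finite        : Finite 𝔽
    toℝ             : 𝔽 → ℝ
    toℝ-injective   : Injective _≡_ _≈_ toℝ
    F-min F-max     : 𝔽
    F-min-least     : ∀ f → toℝ F-min ≤ toℝ f
    F-max-greatest  : ∀ f → toℝ f ≤ toℝ F-max

  𝔽ₑ : Set
  𝔽ₑ = Maybe 𝔽

  𝔽ₑ-space : Space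
  𝔽ₑ-space = discrete 𝔽ₑ

  inj : 𝔽ₑ → ℝₑ
  inj = Maybe.map toℝ

  field
    proj            : ℝₑ → 𝔽ₑ
    proj-cong       : ∀ {r s} → r ≈ₑ s → proj r ≡ proj s
    proj-outside    : ∀ {r} → ¬ r ∈ₑ[ toℝ F-min , toℝ F-max ] → proj r ≡ err
    proj-inj        : ∀ f → proj (inj f) ≡ f

------------------------------------------------------------------------
-- Expressions and tests

data Op : Set where
  add sub mul div : Op

data Comparison : Set where
  le lt eq ne : Comparison

data Expr (𝒱 : Set) : Set where
  const : ℚ.ℚ → Expr 𝒱
  var   : 𝒱 → Expr 𝒱
  neg   : Expr 𝒱 → Expr 𝒱
  bin   : Op → Expr 𝒱 → Expr 𝒱 → Expr 𝒱

data Test (𝒱 : Set) : Set where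
  cmp : Comparison → Expr 𝒱 → Expr 𝒱 → Test 𝒱
  !_  : Test 𝒱 → Test 𝒱

-- The truth values 0 and 1.
𝟚 : Space
𝟚 = discrete (Fin 2)

module Semantics (𝓡 : CompleteOrderedField) (fp : FloatingPoint 𝓡) (𝒱 : Set) where
  open Reals 𝓡
  open FloatingPoint fp

  Σr Σf : Space
  Σr = ℝₑ-space ^ 𝒱
  Σf = 𝔽ₑ-space ^ 𝒱

  ⟦_⟧op : Op → ℝₑ → ℝₑ → ℝₑ
  ⟦ add ⟧op = _+ₑ_
  ⟦ sub ⟧op = _-ₑ_
  ⟦ mul ⟧op = _×ₑ_
  ⟦ div ⟧op = _/ₑ_

  ⟦_⟧ᵉr : Expr 𝒱 → ∣ Σr ∣ → ℝₑ
  ⟦ const a     ⟧ᵉr ρ = just (fromℚ a)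
  ⟦ var x       ⟧ᵉr ρ = ρ x
  ⟦ neg e       ⟧ᵉr ρ = -ₑ ⟦ e ⟧ᵉr ρ
  ⟦ bin o e₁ e₂ ⟧ᵉr ρ = ⟦ o ⟧op (⟦ e₁ ⟧ᵉr ρ) (⟦ e₂ ⟧ᵉr ρ)

  ⟦_⟧ᵉf : Expr 𝒱 → ∣ Σf ∣ → 𝔽ₑ
  ⟦ const a     ⟧ᵉf ρ = proj (just (fromℚ a))
  ⟦ var x       ⟧ᵉf ρ = ρ x
  ⟦ neg e       ⟧ᵉf ρ = proj (-ₑ inj (⟦ e ⟧ᵉf ρ))
  ⟦ bin o e₁ e₂ ⟧ᵉf ρ = proj (⟦ o ⟧op (inj (⟦ e₁ ⟧ᵉf ρ)) (inj (⟦ e₂ ⟧ᵉf ρ)))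

  ⟦_⟧cmp : Comparison → Rel ℝ 0ℓ
  ⟦ le ⟧cmp x y = x ≤ y
  ⟦ lt ⟧cmp x y = x < y
  ⟦ eq ⟧cmp x y = x ≈ y
  ⟦ ne ⟧cmp x y = ¬ x ≈ y

  ⟦_⟧cmp? : ∀ R x y → Dec (⟦ R ⟧cmp x y)
  ⟦ le ⟧cmp? = _≤?_
  ⟦ lt ⟧cmp? = _<?_
  ⟦ eq ⟧cmp? = _≟_
  ⟦ ne ⟧cmp? x y = ¬? (x ≟ y)

  singleton : Fin 2 → ℙ* 𝟚
  singleton v = record
    { set       = ｛ v ｝
    ; respects  = λ x≡y v≡x → ≡.trans v≡x x≡y
    ; non-empty = v , ≡.refl
    }

  both : ℙ* 𝟚
  both = record { set = Unary.U ; respects = _ ; non-empty = 0F , _ }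

  complement : ℙ* 𝟚 → ℙ* 𝟚
  complement S = record
    { set       = λ w → ∃[ v ] v ∈ S.set × w ≡ opposite v
    ; respects  = λ { ≡.refl w∈ → w∈ }
    ; non-empty = let v , v∈S = S.non-empty in opposite v , v , v∈S , ≡.refl
    }
    where module S = ℙ* S

  compareₑ : Comparison → ℝₑ → ℝₑ → ℙ* 𝟚
  compareₑ R (just x) (just y) with ⟦ R ⟧cmp? x y
  ... | yes _ = singleton 1F
  ... | no  _ = singleton 0F
  compareₑ R (just _) err = both
  compareₑ R err      _   = both

  ⟦_⟧r : Test 𝒱 → ∣ Σr ∣ → ℙ* 𝟚
  ⟦ cmp R e₁ e₂ ⟧r ρ = compareₑ R (⟦ e₁ ⟧ᵉr ρ) (⟦ e₂ ⟧ᵉr ρ)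
  ⟦ ! t         ⟧r ρ = complement (⟦ t ⟧r ρ)

  ⟦_⟧f : Test 𝒱 → ∣ Σf ∣ → ℙ* 𝟚
  ⟦ cmp R e₁ e₂ ⟧f ρ = compareₑ R (inj (⟦ e₁ ⟧ᵉf ρ)) (inj (⟦ e₂ ⟧ᵉf ρ))
  ⟦ ! t         ⟧f ρ = complement (⟦ t ⟧f ρ)

{-# OPTIONS --safe #-}
module Submission where

-- Call F : X → ℝₑ measurable when {F ≠ err} and all the sets {F < a} are Borel.
-- A countable dense set Q of reals gives {a < F} = {F ≠ err} ∩ ⋃ {F ≮ q}, over
-- the q > a in Q, and {F < G} = ⋃ {F < q} ∩ {q < G}.  Arithmetic then needs no
-- continuity: F + G < a means F < a - G; for constant c ≠ 0, c F < a compares F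
-- with a / c; 1 / F < a means F > 0 and 1 < a F, or F < 0 and a F < 1; and
-- F G < a compares G with a / F, according to the sign of F.
--
-- A floating-point expression takes values in the finite discrete space 𝔽ₑ, so all its
-- preimages are finite unions of intersections of preimages of its subexpressions.

open import Defs
open import Axiom.ExcludedMiddle using (ExcludedMiddle)
open import Data.Empty using (⊥)
open import Data.Fin.Base using (opposite)
open import Data.Fin.Patterns using (0F; 1F)
open import Data.Fin.Properties using (toℕ-injective)
open import Data.List.Base using ([]; _∷_)
open import Data.List.Relation.Unary.All using ([]; _∷_)
open import Data.Maybe using (Is-just)
open import Data.Maybe.Base as Maybe using (Maybe; just; nothing)
import Data.Maybe.Relation.Binary.Pointwise as Pointwise
open import Data.Maybe.Relation.Unary.Any as Any using (Any; just)
open import Data.Nat.Base using (ℕ; zero; suc)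
open import Data.Product.Base using (∃-syntax; _×_; _,_; proj₁; proj₂)
open import Data.Sum.Base using (_⊎_; inj₁; inj₂; [_,_]′)
open import Function.Base using (_∘_)
open import Function.Bundles using (module Bijection; module Injection; mk↣)
open import Level using (0ℓ; lift; lower)
open import Relation.Binary.Bundles using (Setoid; StrictPartialOrder)
open import Relation.Binary.Core using (Rel)
open import Relation.Binary.Definitions using (_Respects_; tri<; tri≈; tri>)
open import Relation.Binary.PropositionalEquality as ≡ using (_≡_)
open import Relation.Nullary.Decidable.Core using (yes; no; decidable-stable)
open import Relation.Nullary.Negation.Core using (¬_; contradiction)
open import Relation.Unary using (Pred; _∈_; _∪_; _∩_; _⊢_; ⋃)

-- Inequalities in an ordered field.

module OrderedField (𝓡 : CompleteOrderedField) where
  open Reals 𝓡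
  open import Algebra.Properties.Group +-group
    using (//-rightDividesˡ; //-rightDividesʳ)
  open import Algebra.Properties.Ring ring using (-‿distribˡ-*; x[y-z]≈xy-xz; -‿involutive)
  open import Algebra.Properties.Semiring.Mult semiring using (×-assoc-*; ×-congʳ)

  <-strictPartialOrder : StrictPartialOrder 0ℓ 0ℓ 0ℓ
  <-strictPartialOrder = record { isStrictPartialOrder = <.isStrictPartialOrder }

  open import Relation.Binary.Reasoning.StrictPartialOrder <-strictPartialOrder

  ≮⇒≥ : ∀ {x y} → ¬ x < y → y ≤ x
  ≮⇒≥ {x} {y} x≮y with compare x y
  ... | tri< x<y _ _ = contradiction x<y x≮y
  ... | tri≈ _ x≈y _ = inj₂ (sym x≈y)
  ... | tri> _ _ y<x = inj₁ y<x

  ≤⇒≯ : ∀ {x y} → x ≤ y → ¬ y < x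
  ≤⇒≯ (inj₁ x<y) y<x = <.asym x<y y<x
  ≤⇒≯ (inj₂ x≈y) y<x = <.irrefl (sym x≈y) y<x

  x<y+z⇒x-z<y : ∀ {x y z} → x < y + z → x - z < y
  x<y+z⇒x-z<y {x} {y} {z} p = begin-strict
    x - z       <⟨ +-monoˡ-< (- z) p ⟩
    y + z - z   ≈⟨ //-rightDividesʳ z y ⟩
    y           ∎

  x-z<y⇒x<y+z : ∀ {x y z} → x - z < y → x < y + z
  x-z<y⇒x<y+z {x} {y} {z} p = begin-strict
    x           ≈⟨ //-rightDividesˡ z x ⟨
    x - z + z   <⟨ +-monoˡ-< z p ⟩
    y + z       ∎

  x+z<y⇒x<y-z : ∀ {x y z} → x + z < y → x < y - z
  x+z<y⇒x<y-z {x} {y} {z} p = begin-strict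
    x           ≈⟨ //-rightDividesʳ z x ⟨
    x + z - z   <⟨ +-monoˡ-< (- z) p ⟩
    y - z       ∎

  x<y-z⇒x+z<y : ∀ {x y z} → x < y - z → x + z < y
  x<y-z⇒x+z<y {x} {y} {z} p = begin-strict
    x + z       <⟨ +-monoˡ-< z p ⟩
    y - z + z   ≈⟨ //-rightDividesˡ z y ⟩
    y           ∎

  -- Hypothesis and conclusion both amount to x < y + z. Exchanging `y` and `z` swaps them, so the
  -- lemma is its own converse.
  x-y<z⇒x-z<y : ∀ {x y z} → x - y < z → x - z < y
  x-y<z⇒x-z<y {y = y} {z} p = x<y+z⇒x-z<y (<.<-respʳ-≈ (+-comm z y) (x-z<y⇒x<y+z p))

  -x<y⇒-y<x : ∀ {x y} → - x < y → - y < x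
  -x<y⇒-y<x p = <.<-respˡ-≈ (+-identityˡ _)
    (x-y<z⇒x-z<y (<.<-respˡ-≈ (sym (+-identityˡ _)) p))

  x<y⇒0<y-x : ∀ {x y} → x < y → 0# < y - x
  x<y⇒0<y-x p = x+z<y⇒x<y-z (<.<-respˡ-≈ (sym (+-identityˡ _)) p)

  0<y-x⇒x<y : ∀ {x y} → 0# < y - x → x < y
  0<y-x⇒x<y p = <.<-respˡ-≈ (+-identityˡ _) (x<y-z⇒x+z<y p)

  neg-mono-< : ∀ {x y} → x < y → - y < - x
  neg-mono-< {x} p = -x<y⇒-y<x (<.<-respˡ-≈ (sym (-‿involutive x)) p)

  neg-cancel-< : ∀ {x y} → - y < - x → x < y
  neg-cancel-< {x} p = <.<-respˡ-≈ (-‿involutive x) (-x<y⇒-y<x p)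

  x<0⇒0<-x : ∀ {x} → x < 0# → 0# < - x
  x<0⇒0<-x p = <.<-respʳ-≈ (+-identityˡ _) (x<y⇒0<y-x p)

  -- The order axiom for products speaks only of positive numbers, so the inequality passes through
  -- the positive difference `y - x`.
  *-monoˡ-<-pos : ∀ {z x y} → 0# < z → x < y → z * x < z * y
  *-monoˡ-<-pos {z} {x} {y} 0<z x<y =
    0<y-x⇒x<y (<.<-respʳ-≈ (x[y-z]≈xy-xz z y x) (*-pos 0<z (x<y⇒0<y-x x<y)))

  *-monoˡ-<-neg : ∀ {z x y} → z < 0# → x < y → z * y < z * x
  *-monoˡ-<-neg {z} {x} {y} z<0 x<y = neg-cancel-< (begin-strict
    - (z * x)  ≈⟨ -‿distribˡ-* z x ⟩
    - z * x    <⟨ *-monoˡ-<-pos (x<0⇒0<-x z<0) x<y ⟩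
    - z * y    ≈⟨ -‿distribˡ-* z y ⟨
    - (z * y)  ∎)

  *-cancelˡ-<-pos : ∀ {z x y} → 0# < z → z * x < z * y → x < y
  *-cancelˡ-<-pos {z} {x} {y} 0<z p with compare x y
  ... | tri< x<y _ _ = x<y
  ... | tri≈ _ x≈y _ = contradiction p (<.irrefl (*-congˡ x≈y))
  ... | tri> _ _ y<x = contradiction p (<.asym (*-monoˡ-<-pos 0<z y<x))

  *-cancelˡ-<-neg : ∀ {z x y} → z < 0# → z * x < z * y → y < x
  *-cancelˡ-<-neg {z} {x} {y} z<0 p with compare x y
  ... | tri< x<y _ _ = contradiction p (<.asym (*-monoˡ-<-neg z<0 x<y))
  ... | tri≈ _ x≈y _ = contradiction p (<.irrefl (*-congˡ x≈y))
  ... | tri> _ _ y<x = y<x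

  -- Moving a factor across an inequality.

  >⇒≉ : ∀ {x y} → y < x → ¬ x ≈ y
  >⇒≉ y<x x≈y = <.irrefl (sym x≈y) y<x

  x*[y*x⁻¹]≈y : ∀ {x} y → ¬ x ≈ 0# → x * (y * x ⁻¹) ≈ y
  x*[y*x⁻¹]≈y {x} y x≉0 = begin-equality
    x * (y * x ⁻¹)  ≈⟨ *-comm x _ ⟩
    y * x ⁻¹ * x    ≈⟨ *-assoc y _ x ⟩
    y * (x ⁻¹ * x)  ≈⟨ *-congˡ (*-comm _ x) ⟩
    y * (x * x ⁻¹)  ≈⟨ *-congˡ (⁻¹-inverseʳ x≉0) ⟩
    y * 1#          ≈⟨ *-identityʳ y ⟩
    y               ∎

  module _ {z} (0<z : 0# < z) where
    private
      z≉0 : ¬ z ≈ 0#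
      z≉0 = >⇒≉ 0<z

    pos-*<⇒<÷ : ∀ {x y} → z * x < y → x < y * z ⁻¹
    pos-*<⇒<÷ {y = y} p = *-cancelˡ-<-pos 0<z (<.<-respʳ-≈ (sym (x*[y*x⁻¹]≈y y z≉0)) p)

    pos-<÷⇒*< : ∀ {x y} → x < y * z ⁻¹ → z * x < y
    pos-<÷⇒*< {y = y} p = <.<-respʳ-≈ (x*[y*x⁻¹]≈y y z≉0) (*-monoˡ-<-pos 0<z p)

    pos-<*⇒÷< : ∀ {x y} → y < z * x → y * z ⁻¹ < x
    pos-<*⇒÷< {y = y} p = *-cancelˡ-<-pos 0<z (<.<-respˡ-≈ (sym (x*[y*x⁻¹]≈y y z≉0)) p)

    pos-÷<⇒<* : ∀ {x y} → y * z ⁻¹ < x → y < z * x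
    pos-÷<⇒<* {y = y} p = <.<-respˡ-≈ (x*[y*x⁻¹]≈y y z≉0) (*-monoˡ-<-pos 0<z p)

  module _ {z} (z<0 : z < 0#) where
    private
      z≉0 : ¬ z ≈ 0#
      z≉0 z≈0 = <.irrefl z≈0 z<0

    neg-*<⇒÷< : ∀ {x y} → z * x < y → y * z ⁻¹ < x
    neg-*<⇒÷< {y = y} p = *-cancelˡ-<-neg z<0 (<.<-respʳ-≈ (sym (x*[y*x⁻¹]≈y y z≉0)) p)

    neg-÷<⇒*< : ∀ {x y} → y * z ⁻¹ < x → z * x < y
    neg-÷<⇒*< {y = y} p = <.<-respʳ-≈ (x*[y*x⁻¹]≈y y z≉0) (*-monoˡ-<-neg z<0 p)

    neg-<*⇒<÷ : ∀ {x y} → y < z * x → x < y * z ⁻¹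
    neg-<*⇒<÷ {y = y} p = *-cancelˡ-<-neg z<0 (<.<-respˡ-≈ (sym (x*[y*x⁻¹]≈y y z≉0)) p)

    neg-<÷⇒<* : ∀ {x y} → x < y * z ⁻¹ → y < z * x
    neg-<÷⇒<* {y = y} p = <.<-respˡ-≈ (x*[y*x⁻¹]≈y y z≉0) (*-monoˡ-<-neg z<0 p)

  module _ {z} (0<z : 0# < z) where

    -- The case y = 1 of division by `z`. The factors stand in the order `x * z` because
    -- `scale-measurable` puts the constant on the left.
    pos-1<*⇒⁻¹< : ∀ {x} → 1# < x * z → z ⁻¹ < x
    pos-1<*⇒⁻¹< p = <.<-respˡ-≈ (*-identityˡ _) (pos-<*⇒÷< 0<z (<.<-respʳ-≈ (*-comm _ z) p))

    pos-⁻¹<⇒1<* : ∀ {x} → z ⁻¹ < x → 1# < x * z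
    pos-⁻¹<⇒1<* p = <.<-respʳ-≈ (*-comm z _) (pos-÷<⇒<* 0<z (<.<-respˡ-≈ (sym (*-identityˡ _)) p))

  module _ {z} (z<0 : z < 0#) where

    neg-*<1⇒⁻¹< : ∀ {x} → x * z < 1# → z ⁻¹ < x
    neg-*<1⇒⁻¹< p = <.<-respˡ-≈ (*-identityˡ _) (neg-*<⇒÷< z<0 (<.<-respˡ-≈ (*-comm _ z) p))

    neg-⁻¹<⇒*<1 : ∀ {x} → z ⁻¹ < x → x * z < 1#
    neg-⁻¹<⇒*<1 p = <.<-respˡ-≈ (*-comm z _) (neg-÷<⇒*< z<0 (<.<-respˡ-≈ (sym (*-identityˡ _)) p))

  -- The Archimedean property and a countable dense set.

  x<y+x : ∀ {x y} → 0# < y → x < y + x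
  x<y+x p = <.<-respˡ-≈ (+-identityˡ _) (+-monoˡ-< _ p)

  suc·-pos : ∀ n {x} → 0# < x → 0# < suc n · x
  suc·-pos zero    0<x = <.<-respʳ-≈ (sym (+-identityʳ _)) 0<x
  suc·-pos (suc n) 0<x = <.trans (suc·-pos n 0<x) (x<y+x 0<x)

  -- Otherwise the multiples of ε have a supremum s, and s - ε is a smaller upper bound.
  archimedean : ExcludedMiddle 0ℓ → ∀ x {ε} → 0# < ε → ∃[ n ] x < n · ε
  archimedean em x {ε} 0<ε with em {∃[ n ] x < n · ε}
  ... | yes n,x<nε = n,x<nε
  ... | no  ∄n     = contradiction s-ε<s (≤⇒≯ (least bound′))
    where
    multiple : ℝ → Set
    multiple z = ∃[ n ] z ≈ n · ε

    bound : ∀ {z} → multiple z → z ≤ x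
    bound (n , z≈nε) = ≮⇒≥ λ x<z → ∄n (n , <.<-respʳ-≈ z≈nε x<z)

    sup = supremum multiple (0# , 0 , refl) (x , bound)
    s = proj₁ sup
    upper = proj₁ (proj₂ sup)
    least = proj₂ (proj₂ sup)

    s-ε<s : s - ε < s
    s-ε<s = x<y+z⇒x-z<y (<.<-respʳ-≈ (+-comm ε s) (x<y+x 0<ε))

    -- A multiple of `ε` above `s - ε` would be followed by a multiple above `s`.
    bound′ : ∀ {z} → multiple z → z ≤ s - ε
    bound′ {z} (n , z≈nε) = ≮⇒≥ λ s-ε<z →
      ≤⇒≯ (upper (suc n , refl)) (begin-strict
        s           <⟨ x-z<y⇒x<y+z s-ε<z ⟩
        z + ε       ≈⟨ +-comm z ε ⟩
        ε + z       ≈⟨ +-congˡ z≈nε ⟩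
        ε + n · ε   ∎)

  -- Descend from `n` to the first multiple that `x` is not below. The descent cannot run past zero,
  -- because `x` is not negative.
  crossing : ∀ {u x} n → ¬ x < 0# → x < n · u → ∃[ m ] (¬ x < m · u × x < suc m · u)
  crossing         zero    x≮0 x<0 = contradiction x<0 x≮0
  crossing {u} {x} (suc n) x≮0 x<  with x <? n · u
  ... | yes x<nu = crossing n x≮0 x<nu
  ... | no  x≮nu = n , x≮nu , x<

  +-monoʳ-< : ∀ z {x y} → x < y → z + x < z + y
  +-monoʳ-< z p = <.<-respʳ-≈ (+-comm _ z) (<.<-respˡ-≈ (+-comm _ z) (+-monoˡ-< z p))

  +-monoʳ-≤ : ∀ z {x y} → x ≤ y → z + x ≤ z + y
  +-monoʳ-≤ z (inj₁ x<y) = inj₁ (+-monoʳ-< z x<y)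
  +-monoʳ-≤ z (inj₂ x≈y) = inj₂ (+-congˡ x≈y)

  -- Adding a suitable `n · u` makes `x` positive. The first multiple of `u` past the shifted point
  -- overshoots it by at most `u`, which is less than the length of the interval; subtracting
  -- `n · u` again gives the grid point.
  grid-meets-interval : ExcludedMiddle 0ℓ → ∀ {u x y} → 0# < u → u < y - x →
                        ∃[ m ] ∃[ n ] x < m · u - n · u × m · u - n · u < y
  grid-meets-interval em {u} {x} {y} 0<u u<y-x =
    let n , -x<nu          = archimedean em (- x) 0<u
        z                  = n · u + x
        0<z                = x-z<y⇒x<y+z (<.<-respˡ-≈ (sym (+-identityˡ _)) -x<nu)
        k , z<ku           = archimedean em z 0<u
        m , z≮mu , z<u+mu  = crossing k (<.asym 0<z) z<ku
    in suc m , n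
     , x+z<y⇒x<y-z (<.<-respˡ-≈ (+-comm (n · u) x) z<u+mu)
     , x<y+z⇒x-z<y (begin-strict
         u + m · u        ≤⟨ +-monoʳ-≤ u (≮⇒≥ z≮mu) ⟩
         u + (n · u + x)  ≈⟨ +-comm u _ ⟩
         n · u + x + u    ≈⟨ +-assoc (n · u) x u ⟩
         n · u + (x + u)  ≈⟨ +-congˡ (+-comm x u) ⟩
         n · u + (u + x)  <⟨ +-monoʳ-< (n · u) (x<y-z⇒x+z<y u<y-x) ⟩
         n · u + y        ≈⟨ +-comm (n · u) y ⟩
         y + n · u        ∎)

  -- For p > 0 the triple (m , n , p) names the rational (m - n) / p. With natural numbers only, a
  -- union over `Index` is three nested unions over `ℕ`.
  Index : Set
  Index = ℕ × ℕ × ℕ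

  -- With p = 0 the mesh is the unspecified 0# ⁻¹, which does no harm.
  point : Index → ℝ
  point (m , n , p) = m · u - n · u
    where u = (p · 1#) ⁻¹

  -- If 1 < p (y - x), the mesh 1 / p is shorter than the interval, so the grid of that mesh meets
  -- it.
  dense : ExcludedMiddle 0ℓ → ∀ {x y} → x < y → ∃[ i ] x < point i × point i < y
  dense em {x} {y} x<y with archimedean em 1# (x<y⇒0<y-x x<y)
  ... | zero  , 1<0  = contradiction 1<0 (<.asym 0<1)
  ... | suc p , 1<cε =
    let m , n , x<q , q<y = grid-meets-interval em 0<u u<ε in (m , n , suc p) , x<q , q<y
    where
    c = suc p · 1#
    u = c ⁻¹
    ε = y - x

    0<c : 0# < c
    0<c = suc·-pos p 0<1

    cu≈1 : c * u ≈ 1#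
    cu≈1 = ⁻¹-inverseʳ (>⇒≉ 0<c)

    0<u : 0# < u
    0<u = *-cancelˡ-<-pos 0<c (begin-strict
      c * 0#  ≈⟨ zeroʳ c ⟩
      0#      <⟨ 0<1 ⟩
      1#      ≈⟨ cu≈1 ⟨
      c * u   ∎)

    u<ε : u < ε
    u<ε = *-cancelˡ-<-pos 0<c (begin-strict
      c * u               ≈⟨ cu≈1 ⟩
      1#                  <⟨ 1<cε ⟩
      suc p · ε           ≈⟨ ×-congʳ (suc p) (*-identityˡ ε) ⟨
      suc p · (1# * ε)    ≈⟨ ×-assoc-* (suc p) 1# ε ⟨
      c * ε               ∎)

-- Closure properties of the Borel sets.

module BorelSets (em : ExcludedMiddle 0ℓ) (X : Space) where

  -- By excluded middle the set is the whole space or empty. This allows side conditions on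
  -- constants inside Borel combinations.
  const⁺ : ∀ P → Borel X (λ _ → P)
  const⁺ P with em {P}
  ... | yes p = resp≐ ((λ _ → p) , _) (open⁺ (Space.open-U X))
  ... | no ¬p = resp≐ ((λ ¬⊤ → contradiction _ ¬⊤) , λ p → contradiction p ¬p)
                  (∁⁺ (open⁺ (Space.open-U X)))

  ∪⁺ : ∀ {A B} → Borel X A → Borel X B → Borel X (A ∪ B)
  ∪⁺ {A} {B} bA bB = resp≐
    ( (λ { (zero , a) → inj₁ a ; (suc _ , b) → inj₂ b })
    , λ { (inj₁ a) → 0 , a ; (inj₂ b) → 1 , b } )
    (⋃⁺ {A = λ { zero → A ; (suc _) → B }} λ { zero → bA ; (suc _) → bB })

  -- De Morgan: the σ-algebra is generated with complements and unions only.
  ∩⁺ : ∀ {A B} → Borel X A → Borel X B → Borel X (A ∩ B)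
  ∩⁺ {A} {B} bA bB = resp≐
    ( (λ ¬∪ → decidable-stable em (λ ¬a → ¬∪ (inj₁ ¬a))
            , decidable-stable em (λ ¬b → ¬∪ (inj₂ ¬b)))
    , λ (a , b) → [ contradiction a , contradiction b ]′ )
    (∁⁺ (∪⁺ (∁⁺ bA) (∁⁺ bB)))

  -- The union is regrouped over `ℕ` by the fibres of `code`. By injectivity each fibre contributes
  -- a single `A i`, or nothing.
  ⋃-countable⁺ : ∀ {I} → Countable I → {A : I → Pred ∣ X ∣ 0ℓ} →
                 (∀ i → Borel X (A i)) → Borel X (⋃ I A)
  ⋃-countable⁺ {I} I↣ℕ {A} bA = resp≐
    ((λ (_ , i , _ , a) → i , a) , (λ (i , a) → code i , i , ≡.refl , a))
    (⋃⁺ fibre)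
    where
    open Injection I↣ℕ using (injective) renaming (to to code)

    fibre : ∀ n → Borel X (λ x → ∃[ i ] code i ≡ n × A i x)
    fibre n with em {∃[ i ] code i ≡ n}
    ... | yes (i , ≡.refl) = resp≐
      ( (λ a → i , ≡.refl , a)
      , λ { (j , p , a) → ≡.subst (λ k → A k _) (injective p) a } ) (bA i)
    ... | no ∄i = resp≐ ((λ ()) , λ (i , p , _) → ∄i (i , p)) (const⁺ ⊥)

  ⋃-Maybe⁺ : ∀ {I} → Countable I → {A : Maybe I → Pred ∣ X ∣ 0ℓ} →
             (∀ i → Borel X (A i)) → Borel X (⋃ (Maybe I) A)
  ⋃-Maybe⁺ I↣ℕ bA = resp≐
    ( (λ { (inj₁ a) → nothing , a ; (inj₂ (i , a)) → just i , a })
    , λ { (nothing , a) → inj₁ a ; (just i , a) → inj₂ (i , a) } )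
    (∪⁺ (bA nothing) (⋃-countable⁺ I↣ℕ (λ i → bA (just i))))

-- Measurable real functions that may take the value `err`.

module RealFunctions (em : ExcludedMiddle 0ℓ) (𝓡 : CompleteOrderedField) (X : Space) where
  open Reals 𝓡
  open OrderedField 𝓡
  open BorelSets em X

  ⋃-Index⁺ : {A : Index → Pred ∣ X ∣ 0ℓ} → (∀ i → Borel X (A i)) → Borel X (⋃ Index A)
  ⋃-Index⁺ bA = resp≐
    ((λ (m , n , p , a) → (m , n , p) , a) , (λ ((m , n , p) , a) → m , n , p , a))
    (⋃⁺ λ m → ⋃⁺ λ n → ⋃⁺ λ p → bA (m , n , p))

  -- Above the subset {F ≠ err}, this is measurability with respect to the
  -- half-lines ]-∞ , a[ , which generate the Borel sets of ℝ.
  record RayMeasurable (F : ∣ X ∣ → ℝₑ) : Set₁ where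
    field
      defined : Borel X (F ⊢ Is-just)
      below   : ∀ a → Borel X (F ⊢ Any (_< a))

    above : ∀ a → Borel X (F ⊢ Any (a <_))
    above a = resp≐ ((λ {ρ} → to (F ρ)) , λ {ρ} → from (F ρ))
      (⋃-Index⁺ λ i → ∩⁺ (const⁺ (a < point i)) (∩⁺ defined (∁⁺ (below (point i)))))
      where
      to : ∀ r → ∃[ i ] a < point i × Is-just r × ¬ Any (_< point i) r → Any (a <_) r
      -- Only q ≤ x is known here, but a < q is strict, so a < x follows in either case.
      to (just x) (i , a<q , _ , x≮q) with ≮⇒≥ (λ x<q → x≮q (just x<q))
      ... | inj₁ q<x = just (<.trans a<q q<x)
      ... | inj₂ q≈x = just (<.<-respʳ-≈ q≈x a<q)

      from : ∀ r → Any (a <_) r → ∃[ i ] a < point i × Is-just r × ¬ Any (_< point i) r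
      from (just x) (just a<x) =
        let i , a<q , q<x = dense em a<x
        in i , a<q , just _ , λ { (just x<q) → <.asym q<x x<q }

  open RayMeasurable

  const-measurable : ∀ r → RayMeasurable (λ _ → r)
  const-measurable r = record { defined = const⁺ _ ; below = λ _ → const⁺ _ }

  -- Allows an operation to be rewritten as a composite that agrees with it only up to `_≈ₑ_`, as is
  -- done for subtraction and division.
  cong-measurable : ∀ {F G} → (∀ ρ → F ρ ≈ₑ G ρ) → RayMeasurable F → RayMeasurable G
  cong-measurable {F} {G} F≈G mF = record
    { defined = resp≐ ((λ {ρ} → resp _ (F≈G ρ)) , λ {ρ} → resp _ (≈ₑ.sym (F≈G ρ))) (defined mF)
    ; below   = λ a → resp≐
        ( (λ {ρ} → resp <.<-respˡ-≈ (F≈G ρ))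
        , λ {ρ} → resp <.<-respˡ-≈ (≈ₑ.sym (F≈G ρ)) ) (below mF a)
    }
    where
    module ≈ₑ = Setoid (Space.points ℝₑ-space)

    resp : ∀ {P : Pred ℝ 0ℓ} {r s} → P Respects _≈_ → r ≈ₑ s → Any P r → Any P s
    resp P-resp (Pointwise.just x≈y) (just p) = just (P-resp x≈y p)

  module _ {F} (mF : RayMeasurable F) {h : ℝ → ℝ} where

    private
      map-defined : Borel X ((Maybe.map h ∘ F) ⊢ Is-just)
      map-defined = resp≐ ((λ {ρ} → to (F ρ)) , λ {ρ} → from (F ρ)) (defined mF)
        where
        to : ∀ r → Is-just r → Is-just (Maybe.map h r)
        to (just _) _ = just _

        from : ∀ r → Is-just (Maybe.map h r) → Is-just r
        from (just _) _ = just _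

      map-below : ∀ {a} (P : Pred ℝ 0ℓ) → (∀ x → h x < a → P x) → (∀ x → P x → h x < a) →
                  Borel X (F ⊢ Any P) → Borel X ((Maybe.map h ∘ F) ⊢ Any (_< a))
      map-below {a} P to from = resp≐ ((λ {ρ} → from′ (F ρ)) , λ {ρ} → to′ (F ρ))
        where
        to′ : ∀ r → Any (_< a) (Maybe.map h r) → Any P r
        to′ (just x) (just p) = just (to x p)

        from′ : ∀ r → Any P r → Any (_< a) (Maybe.map h r)
        from′ (just x) (just p) = just (from x p)

    -- `h⁻` turns a bound on `h x` into a bound on `x`, so half-lines pull back to half-lines of the
    -- same direction.
    map-increasing : ∀ (h⁻ : ℝ → ℝ) → (∀ x a → h x < a → x < h⁻ a) → (∀ x a → x < h⁻ a → h x < a) →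
                     RayMeasurable (Maybe.map h ∘ F)
    map-increasing h⁻ to from = record
      { defined = map-defined
      ; below   = λ a → map-below (_< h⁻ a) (λ x → to x a) (λ x → from x a) (below mF (h⁻ a))
      }

    map-decreasing : ∀ (h⁻ : ℝ → ℝ) → (∀ x a → h x < a → h⁻ a < x) → (∀ x a → h⁻ a < x → h x < a) →
                     RayMeasurable (Maybe.map h ∘ F)
    map-decreasing h⁻ to from = record
      { defined = map-defined
      ; below   = λ a → map-below (h⁻ a <_) (λ x → to x a) (λ x → from x a) (above mF (h⁻ a))
      }

    -- Covers scaling by zero: the preimage of a half-line is {F ≠ err} or empty, according to the
    -- sign of `a`.
    map-constant : (∀ x → h x ≈ 0#) → RayMeasurable (Maybe.map h ∘ F)
    map-constant h≈0 = record
      { defined = map-defined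
      ; below   = λ a → map-below (λ _ → 0# < a)
                    (λ x → <.<-respˡ-≈ (h≈0 x)) (λ x → <.<-respˡ-≈ (sym (h≈0 x)))
                    (resp≐ ( (λ { (d , p) → Any.map (λ _ → p) d })
                           , λ p → Any.map _ p , proj₂ (Any.satisfied p))
                       (∩⁺ (defined mF) (const⁺ (0# < a))))
      }

  -- Measurability of the arithmetic operations.

  neg-measurable : ∀ {F} → RayMeasurable F → RayMeasurable (-ₑ_ ∘ F)
  neg-measurable mF = map-decreasing mF (λ a → - a) (λ _ _ → -x<y⇒-y<x) (λ _ _ → -x<y⇒-y<x)

  const-sub-measurable : ∀ c {F} → RayMeasurable F → RayMeasurable (Maybe.map (λ x → c - x) ∘ F)
  const-sub-measurable c mF = map-decreasing mF (λ a → c - a)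
    (λ _ _ → x-y<z⇒x-z<y) (λ _ _ → x-y<z⇒x-z<y)

  scale-measurable : ∀ c {F} → RayMeasurable F → RayMeasurable (Maybe.map (c *_) ∘ F)
  scale-measurable c mF with compare c 0#
  ... | tri< c<0 _ _ = map-decreasing mF (λ a → a * c ⁻¹)
                         (λ _ _ → neg-*<⇒÷< c<0) (λ _ _ → neg-÷<⇒*< c<0)
  ... | tri≈ _ c≈0 _ = map-constant mF λ x → trans (*-congʳ c≈0) (zeroˡ x)
  ... | tri> _ _ 0<c = map-increasing mF (λ a → a * c ⁻¹)
                         (λ _ _ → pos-*<⇒<÷ 0<c) (λ _ _ → pos-<÷⇒*< 0<c)

  -- Fails as soon as one side is `err`. Its complement therefore contains the undefined points and
  -- has to be cut down to `both-defined` when a negated comparison of values is meant.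
  Both : Rel ℝ 0ℓ → Rel ℝₑ 0ℓ
  Both R r s = Any (λ x → Any (R x) s) r

  module _ {F G} (mF : RayMeasurable F) (mG : RayMeasurable G) where

    <-borel : Borel X (λ ρ → Both _<_ (F ρ) (G ρ))
    <-borel = resp≐ ((λ {ρ} → to (F ρ) (G ρ)) , λ {ρ} → from (F ρ) (G ρ))
      (⋃-Index⁺ λ i → ∩⁺ (below mF (point i)) (above mG (point i)))
      where
      to : ∀ r s → ∃[ i ] Any (_< point i) r × Any (point i <_) s → Both _<_ r s
      to _ _ (i , just x<q , just q<y) = just (just (<.trans x<q q<y))

      from : ∀ r s → Both _<_ r s → ∃[ i ] Any (_< point i) r × Any (point i <_) s
      from _ _ (just (just x<y)) = let i , x<q , q<y = dense em x<y in i , just x<q , just q<y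

    both-defined : Borel X (λ ρ → Is-just (F ρ) × Is-just (G ρ))
    both-defined = ∩⁺ (defined mF) (defined mG)

    zipWith-defined : ∀ (_∙_ : ℝ → ℝ → ℝ) →
                      Borel X (λ ρ → Is-just (Maybe.zipWith _∙_ (F ρ) (G ρ)))
    zipWith-defined _∙_ = resp≐ ((λ {ρ} → to (F ρ) (G ρ)) , λ {ρ} → from (F ρ) (G ρ)) both-defined
      where
      to : ∀ r s → Is-just r × Is-just s → Is-just (Maybe.zipWith _∙_ r s)
      to _ _ (just _ , just _) = just _

      from : ∀ r s → Is-just (Maybe.zipWith _∙_ r s) → Is-just r × Is-just s
      from (just _) (just _) _ = just _ , just _

  module _ {F G} (mF : RayMeasurable F) (mG : RayMeasurable G) where

    +-measurable : RayMeasurable (λ ρ → F ρ +ₑ G ρ)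
    +-measurable = record
      { defined = zipWith-defined mF mG _+_
      ; below   = λ a → resp≐ ((λ {ρ} → to a (F ρ) (G ρ)) , λ {ρ} → from a (F ρ) (G ρ))
                          (<-borel mF (const-sub-measurable a mG))
      }
      where
      to : ∀ a r s → Both _<_ r (Maybe.map (λ y → a - y) s) → Any (_< a) (r +ₑ s)
      to a (just x) (just y) (just (just p)) = just (x<y-z⇒x+z<y p)

      from : ∀ a r s → Any (_< a) (r +ₑ s) → Both _<_ r (Maybe.map (λ y → a - y) s)
      from a (just x) (just y) (just p) = just (just (x+z<y⇒x<y-z p))

  sub-measurable : ∀ {F G} → RayMeasurable F → RayMeasurable G → RayMeasurable (λ ρ → F ρ -ₑ G ρ)
  sub-measurable {F} {G} mF mG =
    cong-measurable (λ ρ → equal (F ρ) (G ρ)) (+-measurable mF (neg-measurable mG))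
    where
    equal : ∀ r s → r +ₑ (-ₑ s) ≈ₑ r -ₑ s
    equal (just _) (just _) = Pointwise.just refl
    equal (just _) err      = Pointwise.nothing
    equal err      _        = Pointwise.nothing

  -- Being `err` at zero, like `_/ₑ_`, it turns division into multiplication. It also supplies the
  -- quotient a / F in the treatment of products.
  recip : ℝₑ → ℝₑ
  recip err = err
  recip (just y) with y ≟ 0#
  ... | yes _ = err
  ... | no  _ = just (y ⁻¹)

  recip-measurable : ∀ {F} → RayMeasurable F → RayMeasurable (recip ∘ F)
  recip-measurable {F} mF = record
    { defined = resp≐ ((λ {ρ} → defined-to (F ρ)) , λ {ρ} → defined-from (F ρ))
                  -- Asking for a strict sign excludes `err` and zero together.
                  (∪⁺ (below mF 0#) (above mF 0#))
    ; below   = λ a → let maF = scale-measurable a mF in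
        resp≐ ((λ {ρ} → to a (F ρ)) , λ {ρ} → from a (F ρ))
          (∪⁺ (∩⁺ (below mF 0#) (below maF 1#)) (∩⁺ (above mF 0#) (above maF 1#)))
    }
    where
    defined-to : ∀ r → (Any (_< 0#) r ⊎ Any (0# <_) r) → Is-just (recip r)
    defined-to err (inj₁ ())
    defined-to err (inj₂ ())
    defined-to (just y) p with y ≟ 0#
    defined-to (just y) (inj₁ (just y<0)) | yes y≈0 = contradiction y<0 (<.irrefl y≈0)
    defined-to (just y) (inj₂ (just 0<y)) | yes y≈0 = contradiction 0<y (<.irrefl (sym y≈0))
    defined-to (just y) p                 | no _    = just _

    defined-from : ∀ r → Is-just (recip r) → (Any (_< 0#) r ⊎ Any (0# <_) r)
    defined-from (just y) d with y ≟ 0#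
    defined-from (just y) () | yes _
    defined-from (just y) _  | no y≉0 with compare y 0#
    ... | tri< y<0 _ _ = inj₁ (just y<0)
    ... | tri≈ _ y≈0 _ = contradiction y≈0 y≉0
    ... | tri> _ _ 0<y = inj₂ (just 0<y)

    Halves : ℝ → Pred ℝₑ 0ℓ
    Halves a r = (Any (_< 0#) r × Any (_< 1#) (Maybe.map (a *_) r)) ⊎
                 (Any (0# <_) r × Any (1# <_) (Maybe.map (a *_) r))

    to : ∀ a r → Halves a r → Any (_< a) (recip r)
    to a err (inj₁ (() , _))
    to a err (inj₂ (() , _))
    to a (just y) p with y ≟ 0#
    to a (just y) (inj₁ (just y<0 , _)) | yes y≈0 = contradiction y<0 (<.irrefl y≈0)
    to a (just y) (inj₂ (just 0<y , _)) | yes y≈0 = contradiction 0<y (<.irrefl (sym y≈0))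
    to a (just y) (inj₁ (just y<0 , just ay<1)) | no _ = just (neg-*<1⇒⁻¹< y<0 ay<1)
    to a (just y) (inj₂ (just 0<y , just 1<ay)) | no _ = just (pos-1<*⇒⁻¹< 0<y 1<ay)

    from : ∀ a r → Any (_< a) (recip r) → Halves a r
    from a (just y) p with y ≟ 0#
    from a (just y) () | yes _
    from a (just y) (just p) | no y≉0 with compare y 0#
    ... | tri< y<0 _ _ = inj₁ (just y<0 , just (neg-⁻¹<⇒*<1 y<0 p))
    ... | tri≈ _ y≈0 _ = contradiction y≈0 y≉0
    ... | tri> _ _ 0<y = inj₂ (just 0<y , just (pos-⁻¹<⇒1<* 0<y p))

  module _ {F G} (mF : RayMeasurable F) (mG : RayMeasurable G) where

    *-measurable : RayMeasurable (λ ρ → F ρ ×ₑ G ρ)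
    *-measurable = record
      { defined = zipWith-defined mF mG _*_
      ; below   = λ a → let maF⁻¹ = scale-measurable a (recip-measurable mF) in
          resp≐ ((λ {ρ} → to a (F ρ) (G ρ)) , λ {ρ} → from a (F ρ) (G ρ))
            (∪⁺ (∩⁺ (below mF 0#) (<-borel maF⁻¹ mG))
            (∪⁺ (∩⁺ (above mF 0#) (<-borel mG maF⁻¹))
                -- Where F vanishes, a / F is `err` while the product is zero, hence below `a`
                -- exactly when 0 < a. The complement of the two sign sets also contains the points
                -- where F is `err`; `both-defined` removes them.
                (∩⁺ (const⁺ (0# < a)) (∩⁺ (both-defined mF mG)
                                          (∁⁺ (∪⁺ (below mF 0#) (above mF 0#)))))))
      }
      where
      quotient : ℝ → ℝₑ → ℝₑ
      quotient a r = Maybe.map (a *_) (recip r)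

      SignCases : ℝ → Rel ℝₑ 0ℓ
      SignCases a r s =
        (Any (_< 0#) r × Both _<_ (quotient a r) s) ⊎
        (Any (0# <_) r × Both _<_ s (quotient a r)) ⊎
        (0# < a × (Is-just r × Is-just s) × ¬ (Any (_< 0#) r ⊎ Any (0# <_) r))

      to : ∀ a r s → SignCases a r s → Any (_< a) (r ×ₑ s)
      to a err s (inj₁ (() , _))
      to a err s (inj₂ (inj₁ (() , _)))
      to a err s (inj₂ (inj₂ (_ , (() , _) , _)))
      to a (just x) err (inj₂ (inj₁ (_ , ())))
      to a (just x) err (inj₂ (inj₂ (_ , (_ , ()) , _)))
      -- This decision makes `quotient a (just x)` compute. At zero it is `err`, so the two cases
      -- that compare with it become empty.
      to a (just x) s p with x ≟ 0#
      to a (just x) err (inj₁ (_ , just ())) | no _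
      to a (just x) (just y) (inj₁ (just x<0 , just (just p))) | no _ = just (neg-÷<⇒*< x<0 p)
      to a (just x) (just y) (inj₂ (inj₁ (just 0<x , just (just p)))) | no _ =
        just (pos-<÷⇒*< 0<x p)
      to a (just x) (just y) (inj₂ (inj₂ (0<a , _))) | yes x≈0 =
        just (<.<-respˡ-≈ (sym (trans (*-congʳ x≈0) (zeroˡ y))) 0<a)
      to a (just x) s (inj₂ (inj₁ (_ , just ()))) | yes _
      to a (just x) s (inj₂ (inj₂ (_ , _ , x≯≮0))) | no x≉0 with compare x 0#
      ... | tri< x<0 _ _ = contradiction (inj₁ (just x<0)) x≯≮0
      ... | tri≈ _ x≈0 _ = contradiction x≈0 x≉0
      ... | tri> _ _ 0<x = contradiction (inj₂ (just 0<x)) x≯≮0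

      from : ∀ a r s → Any (_< a) (r ×ₑ s) → SignCases a r s
      -- The first test makes `recip` compute, the second supplies the sign.
      from a (just x) (just y) (just p) with x ≟ 0# | compare x 0#
      ... | yes x≈0 | _              = inj₂ (inj₂ (<.<-respˡ-≈ (trans (*-congʳ x≈0) (zeroˡ y)) p
        , (just _ , just _)
        , λ { (inj₁ (just x<0)) → <.irrefl x≈0 x<0 ; (inj₂ (just 0<x)) → <.irrefl (sym x≈0) 0<x }))
      ... | no _    | tri< x<0 _ _ = inj₁ (just x<0 , just (just (neg-*<⇒÷< x<0 p)))
      ... | no x≉0  | tri≈ _ x≈0 _ = contradiction x≈0 x≉0
      ... | no _    | tri> _ _ 0<x = inj₂ (inj₁ (just 0<x , just (just (pos-*<⇒<÷ 0<x p))))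

  ÷-measurable : ∀ {F G} → RayMeasurable F → RayMeasurable G → RayMeasurable (λ ρ → F ρ /ₑ G ρ)
  ÷-measurable {F} {G} mF mG =
    cong-measurable (λ ρ → equal (F ρ) (G ρ)) (*-measurable mF (recip-measurable mG))
    where
    equal : ∀ r s → r ×ₑ recip s ≈ₑ r /ₑ s
    equal (just x) (just y) with y ≟ 0#
    ... | yes _ = Pointwise.nothing
    ... | no  _ = Pointwise.just refl
    equal (just _) err = Pointwise.nothing
    equal err      _   = Pointwise.nothing

-- Measurability of tests.

module Tests (em : ExcludedMiddle 0ℓ) (𝓡 : CompleteOrderedField) (fp : FloatingPoint 𝓡)
             (𝒱 : Set) where
  open Reals 𝓡
  open OrderedField 𝓡
  open FloatingPoint fp
  open Semantics 𝓡 fp 𝒱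

  -- The image of T under `opposite` meets `U` exactly when T meets the preimage of `U`, which is
  -- again open because `𝟚` is discrete.
  complement-measurable : ∀ {X} {T : ∣ X ∣ → ℙ* 𝟚} →
                          Measurable* X 𝟚 T → Measurable* X 𝟚 (complement ∘ T)
  complement-measurable mT {U} _ = resp≐
    ( (λ (v , v∈T , v∈U) → opposite v , (v , v∈T , ≡.refl) , v∈U)
    , λ { (_ , (v , v∈T , ≡.refl) , v∈U) → v , v∈T , v∈U } )
    (mT {opposite ⊢ U} _)

  -- Tests over the reals.

  module RealSemantics where
    open RealFunctions em 𝓡 Σr
    open BorelSets em Σr

    -- A constraint on one coordinate is a basic open cylinder.
    coordinate-borel : ∀ x U → Space.Open ℝₑ-space U → Borel Σr (λ ρ → ρ x ∈ U)
    coordinate-borel x U oU =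
      open⁺ λ ρx∈U → (x , U , oU) ∷ [] , ρx∈U ∷ [] , λ { (σx∈U ∷ []) → σx∈U }

    coordinate-measurable : ∀ x → RayMeasurable (λ ρ → ρ x)
    coordinate-measurable x = record
      { defined = coordinate-borel x Is-just
          (lift λ _ → let a , b , axb , _ = lower (Space.open-U ℝₑ-space) _ in
                      a , b , axb , λ _ _ → just _)
      ; below   = λ a → coordinate-borel x (Any (_< a))
          (lift λ { {y} (just y<a) →
            -- The ray is unbounded below, so any number under `y` serves as left end of the
            -- neighbourhood.
            y - 1# , a , (x<y+z⇒x-z<y (<.<-respʳ-≈ (+-comm 1# y) (x<y+x 0<1)) , y<a) ,
            λ _ z<a → just z<a })
      }

    expression-measurable : ∀ e → RayMeasurable ⟦ e ⟧ᵉr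
    expression-measurable (const a)         = const-measurable (just (fromℚ a))
    expression-measurable (var x)           = coordinate-measurable x
    expression-measurable (neg e)           = neg-measurable (expression-measurable e)
    expression-measurable (bin add e₁ e₂) =
      +-measurable (expression-measurable e₁) (expression-measurable e₂)
    expression-measurable (bin sub e₁ e₂) =
      sub-measurable (expression-measurable e₁) (expression-measurable e₂)
    expression-measurable (bin mul e₁ e₂) =
      *-measurable (expression-measurable e₁) (expression-measurable e₂)
    expression-measurable (bin div e₁ e₂) =
      ÷-measurable (expression-measurable e₁) (expression-measurable e₂)

    -- By trichotomy everything reduces to the strict order: ≤ is the complement of the reversed
    -- `_<_`, ≠ the union of both strict orders, and equality the complement of ≠. Complements are
    -- taken among the points where both functions are defined.
    comparison-borel : ∀ R {F G} → RayMeasurable F → RayMeasurable G →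
                       Borel Σr (λ ρ → Both ⟦ R ⟧cmp (F ρ) (G ρ))
    comparison-borel lt mF mG = <-borel mF mG
    comparison-borel le {F} {G} mF mG = resp≐
      ((λ {ρ} → to (F ρ) (G ρ)) , λ {ρ} → from (F ρ) (G ρ))
      (∩⁺ (both-defined mF mG) (∁⁺ (<-borel mG mF)))
      where
      to : ∀ r s → (Is-just r × Is-just s) × ¬ Both _<_ s r → Both _≤_ r s
      to (just x) (just y) (_ , y≮x) = just (just (≮⇒≥ λ y<x → y≮x (just (just y<x))))
      to (just x) err ((_ , ()) , _)
      to err _ ((() , _) , _)

      from : ∀ r s → Both _≤_ r s → (Is-just r × Is-just s) × ¬ Both _<_ s r
      from (just x) (just y) (just (just x≤y)) =
        (just _ , just _) , λ { (just (just y<x)) → ≤⇒≯ x≤y y<x }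
    comparison-borel ne {F} {G} mF mG = resp≐
      ((λ {ρ} → to (F ρ) (G ρ)) , λ {ρ} → from (F ρ) (G ρ))
      (∪⁺ (<-borel mF mG) (<-borel mG mF))
      where
      to : ∀ r s → Both _<_ r s ⊎ Both _<_ s r → Both (λ x y → ¬ x ≈ y) r s
      to _ _ (inj₁ (just (just x<y))) = just (just λ x≈y → <.irrefl x≈y x<y)
      to _ _ (inj₂ (just (just y<x))) = just (just (>⇒≉ y<x))

      from : ∀ r s → Both (λ x y → ¬ x ≈ y) r s → Both _<_ r s ⊎ Both _<_ s r
      from (just x) (just y) (just (just x≉y)) with compare x y
      ... | tri< x<y _ _ = inj₁ (just (just x<y))
      ... | tri≈ _ x≈y _ = contradiction x≈y x≉y
      ... | tri> _ _ y<x = inj₂ (just (just y<x))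
    comparison-borel eq {F} {G} mF mG = resp≐
      ((λ {ρ} → to (F ρ) (G ρ)) , λ {ρ} → from (F ρ) (G ρ))
      (∩⁺ (both-defined mF mG) (∁⁺ (comparison-borel ne mF mG)))
      where
      to : ∀ r s → (Is-just r × Is-just s) × ¬ Both ⟦ ne ⟧cmp r s → Both _≈_ r s
      to (just x) (just y) (_ , ¬x≉y) =
        just (just (decidable-stable (x ≟ y) λ x≉y → ¬x≉y (just (just x≉y))))
      to (just x) err ((_ , ()) , _)
      to err _ ((() , _) , _)

      from : ∀ r s → Both _≈_ r s → (Is-just r × Is-just s) × ¬ Both ⟦ ne ⟧cmp r s
      from (just x) (just y) (just (just x≈y)) =
        (just _ , just _) , λ { (just (just x≉y)) → x≉y x≈y }

    -- The outcome 1 is possible when an operand is `err` or the comparison holds. The outcome 0 is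
    -- possible exactly when `Both` fails, which already includes the `err` cases. `U` is met when
    -- it contains a possible outcome.
    cmp-measurable : ∀ R {F G} → RayMeasurable F → RayMeasurable G →
                     Measurable* Σr 𝟚 (λ ρ → compareₑ R (F ρ) (G ρ))
    cmp-measurable R {F} {G} mF mG {U} _ = resp≐
      ((λ {ρ} → to (F ρ) (G ρ)) , λ {ρ} → from (F ρ) (G ρ))
      (∪⁺ (∩⁺ (const⁺ (1F ∈ U)) (∪⁺ (∁⁺ (both-defined mF mG)) (comparison-borel R mF mG)))
          (∩⁺ (const⁺ (0F ∈ U)) (∁⁺ (comparison-borel R mF mG))))
      where
      Outcomes : Rel ℝₑ 0ℓ
      Outcomes r s =
        (1F ∈ U × (¬ (Is-just r × Is-just s) ⊎ Both ⟦ R ⟧cmp r s)) ⊎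
        (0F ∈ U × ¬ Both ⟦ R ⟧cmp r s)

      to : ∀ r s → Outcomes r s → ◇ 𝟚 U (compareₑ R r s)
      to (just x) (just y) p with ⟦ R ⟧cmp? x y | p
      ... | yes _  | inj₁ (1∈U , _)                  = 1F , ≡.refl , 1∈U
      ... | yes xy | inj₂ (_ , ¬xy)                  = contradiction (just (just xy)) ¬xy
      ... | no _   | inj₁ (_ , inj₁ ¬d)              = contradiction (just _ , just _) ¬d
      ... | no ¬xy | inj₁ (_ , inj₂ (just (just xy))) = contradiction xy ¬xy
      ... | no _   | inj₂ (0∈U , _)                  = 0F , ≡.refl , 0∈U
      to (just _) err (inj₁ (1∈U , _)) = 1F , _ , 1∈U
      to (just _) err (inj₂ (0∈U , _)) = 0F , _ , 0∈U
      to err      _   (inj₁ (1∈U , _)) = 1F , _ , 1∈U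
      to err      _   (inj₂ (0∈U , _)) = 0F , _ , 0∈U

      from : ∀ r s → ◇ 𝟚 U (compareₑ R r s) → Outcomes r s
      from (just x) (just y) p with ⟦ R ⟧cmp? x y | p
      ... | yes xy | _ , ≡.refl , 1∈U = inj₁ (1∈U , inj₂ (just (just xy)))
      ... | no ¬xy | _ , ≡.refl , 0∈U = inj₂ (0∈U , λ { (just (just xy)) → ¬xy xy })
      from (just _) err (1F , _ , 1∈U) = inj₁ (1∈U , inj₁ λ ())
      from (just _) err (0F , _ , 0∈U) = inj₂ (0∈U , λ { (just ()) })
      from err      _   (1F , _ , 1∈U) = inj₁ (1∈U , inj₁ λ ())
      from err      _   (0F , _ , 0∈U) = inj₂ (0∈U , λ ())

    test-measurable : ∀ t → Measurable* Σr 𝟚 ⟦ t ⟧r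
    test-measurable (cmp R e₁ e₂) =
      cmp-measurable R (expression-measurable e₁) (expression-measurable e₂)
    test-measurable (! t) = complement-measurable {T = ⟦ t ⟧r} (test-measurable t)

  -- Tests over floating-point numbers.

  module FloatSemantics where
    open BorelSets em Σf

    -- All subsets are demanded, so following F by an arbitrary map out of `𝔽ₑ` only replaces `P` by
    -- its preimage.
    PreimagesBorel : (∣ Σf ∣ → 𝔽ₑ) → Set₁
    PreimagesBorel F = ∀ (P : Pred 𝔽ₑ 0ℓ) → Borel Σf (F ⊢ P)

    𝔽-countable : Countable 𝔽
    𝔽-countable = mk↣ (λ p → Bijection.injective 𝔽⤖Fin (toℕ-injective p))
      where 𝔽⤖Fin = proj₂ 𝔽-finite

    binary-borel : ∀ {F G} → PreimagesBorel F → PreimagesBorel G → ∀ (W : Rel 𝔽ₑ 0ℓ) →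
                   Borel Σf (λ ρ → W (F ρ) (G ρ))
    binary-borel {F} bF bG W = resp≐
      ((λ { (_ , ≡.refl , w) → w }) , λ w → _ , ≡.refl , w)
      -- `W` is sliced by the value `f` of the first function; on each slice it is a condition on
      -- the second function alone.
      (⋃-Maybe⁺ 𝔽-countable λ f → ∩⁺ (bF (f ≡_)) (bG (W f)))

    expression-borel : ∀ e → PreimagesBorel ⟦ e ⟧ᵉf
    expression-borel (const a) P     = const⁺ _
    expression-borel (var x) P       =
      open⁺ λ ρx∈P → (x , P , _) ∷ [] , ρx∈P ∷ [] , λ { (σx∈P ∷ []) → σx∈P }
    expression-borel (neg e) P       = expression-borel e (λ f → P (proj (-ₑ inj f)))
    expression-borel (bin o e₁ e₂) P =
      binary-borel (expression-borel e₁) (expression-borel e₂)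
        λ f g → P (proj (⟦ o ⟧op (inj f) (inj g)))

    test-measurable : ∀ t → Measurable* Σf 𝟚 ⟦ t ⟧f
    test-measurable (cmp R e₁ e₂) {U} _ =
      -- For fixed `U`, whether the outcome set meets `U` is a relation between the two operand
      -- values.
      binary-borel (expression-borel e₁) (expression-borel e₂)
        λ f g → ◇ 𝟚 U (compareₑ R (inj f) (inj g))
    test-measurable (! t) = complement-measurable {T = ⟦ t ⟧f} (test-measurable t)

proposition2 : ExcludedMiddle 0ℓ →
    (𝓡 : CompleteOrderedField) (fp : FloatingPoint 𝓡) →
    (𝒱 : Set) → Countable 𝒱 →
    let open Reals 𝓡
        open FloatingPoint fp
        open Semantics 𝓡 fp 𝒱
    in
    ((t : Test 𝒱) → Measurable* Σr 𝟚 ⟦ t ⟧r)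
    ×
    (Finite 𝒱 ⊎ Measurable ℝₑ-space 𝔽ₑ-space proj →
     (t : Test 𝒱) → Measurable* Σf 𝟚 ⟦ t ⟧f)
proposition2 em 𝓡 fp 𝒱 _ = RealSemantics.test-measurable , λ _ → FloatSemantics.test-measurable
  where open Tests em 𝓡 fp 𝒱
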